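{- Let $\Phi$ be an $\mathcal{S}i\mathbf{LK}$-proof of a component collection $\mathbf{C}$. Then there exists an $\mathcal{S}i\mathbf{LK}$-proof $\Phi'$ of the same component collection $\mathbf{C}$ which is in pre-proof schema normal form.
   Context: Language. Two-sorted classical first-order logic. Sort $\omega$: numerals built from $0$ and successor $s$ (with $s(N)\neq 0$, $s(N)=s(N')\to N=N'$), together with a single numeric parameter $n$ (the free parameter); numeric expressions may contain $n$. Sort $\iota$: first-order terms built from uninterpreted function symbols, defined function symbols (marked $\widehat{\cdot}$) and schematic variables (symbols $x$ of type $\omega\to\iota$, so $x(\alpha)$ is an $\iota$-variable for a numeral $\alpha$). Formula schemata are built with the usual connectives and quantifiers from uninterpreted and defined predicate symbols. An equational theory $\mathcal{E}$ is a convergent set of rewrite rules $\widehat{f}(\bar t)\equiv E$ ($\bar t$ without defined symbols) defining the defined symbols. A sequent is $\Delta\vdash\Pi$ with $\Delta,\Pi$ multisets of formula schemata. $\mathbf{LKE}$ is Gentzen's $\mathbf{LK}$ (axioms $A\vdash A$, structural rules, cut, logical rules) extended by the rule: from $S(t)$ infer $S(t')$ whenever $\mathcal{E}\models t\equiv t'$. Component collections. A component pair $\langle\nu;\pi\rangle$ has a stepcase $\nu$ and a basecase $\pi$. A basecase is a sequent or a closed sequent $[S]$; a stepcase is $\top$, a sequent annotated by a numeric expression, $\Lambda\vdash^{\alpha}\Gamma$, a closed sequent $[S]$, or the empty closure $[\ ]$. A component group is a finite multiset of component pairs; a component collection is a finite multiset of component groups, written $G_1\mid\cdots\mid G_m$.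 A group is closed if it is a single pair whose stepcase is of the form $[S]$ or $[\ ]$, otherwise open; rules are applied only to open groups. Below $\mathbb{\Gamma}$ denotes the remaining pairs of a group and $\mathbf{\Pi}$, $\mathbf{\Delta}$ remaining groups. The $\mathcal{S}i\mathbf{LK}$ rules (premise $\Rightarrow$ conclusion) are: $Ax_1{:}r$: $\mathbf{\Pi}\Rightarrow \langle\top;A\vdash A\rangle\mid\mathbf{\Pi}$; $Ax_2{:}r$: $\mathbb{\Gamma}\mid\mathbf{\Pi}\Rightarrow\langle\top;A\vdash A\rangle,\mathbb{\Gamma}\mid\mathbf{\Pi}$; $Ax{:}l$: $\langle\top;[\pi]\rangle,\mathbb{\Gamma}\mid\mathbf{\Pi}\Rightarrow\langle A\vdash^{f(n)}A;[\pi]\rangle,\mathbb{\Gamma}\mid\mathbf{\Pi}$; $c_c{:}r$: $\langle\top;\pi\rangle,\langle\top;\pi\rangle,\mathbb{\Gamma}\mid\mathbf{\Pi}\Rightarrow\langle\top;\pi\rangle,\mathbb{\Gamma}\mid\mathbf{\Pi}$; $c_c{:}l$: $\langle\nu;[\pi]\rangle,\langle\nu;[\pi]\rangle,\mathbb{\Gamma}\mid\mathbf{\Pi}\Rightarrow\langle\nu;[\pi]\rangle,\mathbb{\Gamma}\mid\mathbf{\Pi}$; $br$: $\langle\nu;[\pi]\rangle,\mathbb{\Gamma}\mid\mathbf{\Pi}\Rightarrow\langle\top;[\pi]\rangle,\langle\nu;[\pi]\rangle,\mathbb{\Gamma}\mid\mathbf{\Pi}$; $cl_{bc}$: $\langle\top;\nu\rangle,\mathbb{\Gamma}\mid\mathbf{\Pi}\Rightarrow\langle\top;[\nu]\rangle,\mathbb{\Gamma}\mid\mathbf{\Pi}$;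 $cl_{LKE}$: $\langle\top;[\nu]\rangle\mid\mathbf{\Pi}\Rightarrow\langle[\ ];[\nu]\rangle\mid\mathbf{\Pi}$; $cl_{sc}$: $\langle(\Pi\vdash^{\alpha}\Delta)[n\setminus\alpha];[(\Pi\vdash\Delta)[n\setminus 0]]\rangle\mid\mathbf{\Pi}\Rightarrow\langle[(\Pi\vdash\Delta)[n\setminus\alpha]];[(\Pi\vdash\Delta)[n\setminus 0]]\rangle\mid\mathbf{\Pi}$; $\rho_1^{bc},\rho_2^{bc}$: apply a unary (binary) $\mathbf{LKE}$ rule $\rho$ to the basecase(s) of pair(s) $\langle\top;\pi\rangle$ (and $\langle\top;\eta\rangle$) in the same group, replacing them by $\langle\top;\pi'\rangle$ with $\pi'$ the conclusion; $\rho_1^{sc},\rho_2^{sc}$: likewise on the stepcases of $\langle\nu;[\pi]\rangle$ (and $\langle\mu;[\pi]\rangle$), giving $\langle\nu';[\pi]\rangle$; $\circlearrowright$: $\langle\top;[(\Pi\vdash\Delta)[n\setminus0]]\rangle,\mathbb{\Gamma}\mid\mathbf{\Pi}\Rightarrow\langle(\Pi\vdash^{(n+1)}\Delta)[n\setminus n][\bar x\setminus\bar t];[(\Pi\vdash\Delta)[n\setminus0]]\rangle,\mathbb{\Gamma}\mid\mathbf{\Pi}$, where $\bar x$ are the free variables of $\Pi\vdash\Delta$ and $\bar t$ arbitrary terms of the same length; $\curvearrowright$: $\langle\top;[\pi]\rangle,\mathbb{\Gamma}\mid\mathbf{\Delta}\mid\langle[(\Lambda\vdash\Gamma)[n\setminus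 h(n)]];[\delta]\rangle\mid\mathbf{\Pi}\Rightarrow\langle(\Lambda\vdash^{f(n)}\Gamma)[n\setminus g(n)][\bar y\setminus\bar t];[\pi]\rangle,\mathbb{\Gamma}\mid\mathbf{\Delta}\mid\langle[(\Lambda\vdash\Gamma)[n\setminus h(n)]];[\delta]\rangle\mid\mathbf{\Pi}$, where the linked group is closed, $g,h$ (and $f$) are primitive recursive functions (possibly added to $\mathcal{E}$), $\bar y$ are the free variables of $\Lambda\vdash\Gamma$ and $\bar t$ arbitrary terms. An $\mathcal{S}i\mathbf{LK}$-derivation is a sequence of such inferences ending in a collection with an open group; an $\mathcal{S}i\mathbf{LK}$-proof is one ending in a collection all of whose groups are closed. It is in pre-proof schema normal form if for every application of $Ax_1{:}r$ the context $\mathbf{\Pi}$ (the premise collection) is itself the conclusion of an $\mathcal{S}i\mathbf{LK}$-proof (all its groups closed). -}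

module Defs where

open import Data.Nat using (ℕ; zero; suc; _≤ᵇ_; _≡ᵇ_; _∸_)
open import Data.Bool using (Bool; true; false; if_then_else_; _∧_; T)
open import Data.List using (List; []; _∷_; _++_; map)
open import Data.List.Relation.Unary.Any using (Any)
open import Data.List.Relation.Unary.All using (All)
open import Data.List.Membership.Propositional using (_∈_)
open import Data.List.Relation.Binary.Permutation.Propositional using (_↭_)
import Data.List.Relation.Binary.Permutation.Homogeneous as PH
open import Data.Product using (Σ; _×_; _,_; ∃; proj₁)
open import Data.Sum using (_⊎_)
open import Data.Unit using (⊤; tt)
open import Data.Empty using (⊥)
open import Relation.Nullary using (¬_)
open import Relation.Binary.Construct.Closure.ReflexiveTransitive using (Star)
open import Relation.Binary.Construct.Closure.Equivalence using (EqClosure)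
open import Induction.WellFounded using (WellFounded)
open import Function using (flip; id)

-- Numeric expressions (sort ω).
data NExp : Set where
  nzero : NExp
  nsuc  : NExp → NExp
  npar  : NExp                     -- the free numeric parameter n
  nv    : ℕ → NExp                 -- numeric pattern variable (used in rules of E)
  nfun  : ℕ → List NExp → NExp     -- defined numeric function symbol  f̂(ē)

-- Terms (sort ι).  Bound (quantified) variables use de Bruijn indices.
data Term : Set where
  bv  : ℕ → Term
  mv  : ℕ → Term                          -- ι pattern variable (used in rules of E)
  sv  : ℕ → NExp → Term                   -- schematic variable x(α)
  fn  : ℕ → List Term → Term              -- uninterpreted function symbol
  dfn : ℕ → List NExp → List Term → Term  -- defined function symbol  f̂(ē, t̄)

data Formula : Set where
  pr   : ℕ → List Term → Formula              -- uninterpreted predicate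
  dpr  : ℕ → List NExp → List Term → Formula  -- defined predicate  P̂(ē, t̄)
  ¬'   : Formula → Formula
  _∧'_ : Formula → Formula → Formula
  _∨'_ : Formula → Formula → Formula
  _⇒'_ : Formula → Formula → Formula
  ∀'   : Formula → Formula
  ∃'   : Formula → Formula

infix 4 _⊢_
record Sequent : Set where
  constructor _⊢_
  field
    ante : List Formula
    succ : List Formula
open Sequent public

mutual
  nsubst : NExp → (ℕ → NExp) → NExp → NExp
  nsubst p ρ nzero       = nzero
  nsubst p ρ (nsuc e)    = nsuc (nsubst p ρ e)
  nsubst p ρ npar        = p
  nsubst p ρ (nv k)      = ρ k
  nsubst p ρ (nfun f es) = nfun f (nsubsts p ρ es)

  nsubsts : NExp → (ℕ → NExp) → List NExp → List NExp
  nsubsts p ρ []       = []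
  nsubsts p ρ (e ∷ es) = nsubst p ρ e ∷ nsubsts p ρ es

-- generic traversal: ν acts on numeric subexpressions, ℓ on variable
-- leaves (given the current binder depth)
mutual
  tmap : (NExp → NExp) → (ℕ → Term → Term) → ℕ → Term → Term
  tmap ν ℓ d (bv k)       = ℓ d (bv k)
  tmap ν ℓ d (mv k)       = ℓ d (mv k)
  tmap ν ℓ d (sv x e)     = ℓ d (sv x (ν e))
  tmap ν ℓ d (fn f ts)    = fn f (tmaps ν ℓ d ts)
  tmap ν ℓ d (dfn f es ts) = dfn f (map ν es) (tmaps ν ℓ d ts)

  tmaps : (NExp → NExp) → (ℕ → Term → Term) → ℕ → List Term → List Term
  tmaps ν ℓ d []       = []
  tmaps ν ℓ d (t ∷ ts) = tmap ν ℓ d t ∷ tmaps ν ℓ d ts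

fmap : (NExp → NExp) → (ℕ → Term → Term) → ℕ → Formula → Formula
fmap ν ℓ d (pr P ts)     = pr P (tmaps ν ℓ d ts)
fmap ν ℓ d (dpr P es ts) = dpr P (map ν es) (tmaps ν ℓ d ts)
fmap ν ℓ d (¬' A)        = ¬' (fmap ν ℓ d A)
fmap ν ℓ d (A ∧' B)      = fmap ν ℓ d A ∧' fmap ν ℓ d B
fmap ν ℓ d (A ∨' B)      = fmap ν ℓ d A ∨' fmap ν ℓ d B
fmap ν ℓ d (A ⇒' B)      = fmap ν ℓ d A ⇒' fmap ν ℓ d B
fmap ν ℓ d (∀' A)        = ∀' (fmap ν ℓ (suc d) A)
fmap ν ℓ d (∃' A)        = ∃' (fmap ν ℓ (suc d) A)

idLeaf : ℕ → Term → Term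
idLeaf _ t = t

shiftLeaf : ℕ → Term → Term
shiftLeaf d (bv k) = if d ≤ᵇ k then bv (suc k) else bv k
shiftLeaf d t      = t

shift : Term → Term
shift = tmap id shiftLeaf 0

shiftN : ℕ → Term → Term
shiftN zero    t = t
shiftN (suc m) t = shift (shiftN m t)

-- instantiate the outermost bound variable of a quantifier body by t
instLeaf : Term → ℕ → Term → Term
instLeaf t d (bv k) = if k ≡ᵇ d then shiftN d t else (if d ≤ᵇ k then bv (k ∸ 1) else bv k)
instLeaf t d u      = u

inst : Formula → Term → Formula
inst A t = fmap id (instLeaf t) 0 A

parF : NExp → Formula → Formula
parF e = fmap (nsubst e nv) idLeaf 0

parS : NExp → Sequent → Sequent
parS e (Γ ⊢ Δ) = map (parF e) Γ ⊢ map (parF e) Δ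

svLeaf : (ℕ → NExp → Term) → ℕ → Term → Term
svLeaf σ d (sv x e) = shiftN d (σ x e)
svLeaf σ d t        = t

svF : (ℕ → NExp → Term) → Formula → Formula
svF σ = fmap id (svLeaf σ) 0

svS : (ℕ → NExp → Term) → Sequent → Sequent
svS σ (Γ ⊢ Δ) = map (svF σ) Γ ⊢ map (svF σ) Δ

mvLeaf : (ℕ → Term) → ℕ → Term → Term
mvLeaf θ d (mv k) = shiftN d (θ k)
mvLeaf θ d t      = t

instN : (ℕ → NExp) → NExp → NExp
instN θn = nsubst npar θn

instTs : (ℕ → NExp) → (ℕ → Term) → List Term → List Term
instTs θn θt = tmaps (instN θn) (mvLeaf θt) 0

instT : (ℕ → NExp) → (ℕ → Term) → Term → Term
instT θn θt = tmap (instN θn) (mvLeaf θt) 0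

instF : (ℕ → NExp) → (ℕ → Term) → Formula → Formula
instF θn θt = fmap (instN θn) (mvLeaf θt) 0

-- rewrite rules  f̂(ē) ≡ e ,  f̂(ē,t̄) ≡ t ,  P̂(ē,t̄) ≡ F
data ERule : Set where
  nrule : ℕ → List NExp → NExp → ERule
  trule : ℕ → List NExp → List Term → Term → ERule
  prule : ℕ → List NExp → List Term → Formula → ERule

module _ (E : List ERule) where

  mutual
    data _⟶N_ : NExp → NExp → Set where
      rootN : ∀ {f as r} (θn : ℕ → NExp) → nrule f as r ∈ E →
              nfun f (map (instN θn) as) ⟶N instN θn r
      sucN  : ∀ {a b} → a ⟶N b → nsuc a ⟶N nsuc b
      funN  : ∀ {f as bs} → as ⟶Ns bs → nfun f as ⟶N nfun f bs

    data _⟶Ns_ : List NExp → List NExp → Set where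
      hereNs  : ∀ {a b as} → a ⟶N b → (a ∷ as) ⟶Ns (b ∷ as)
      thereNs : ∀ {a as bs} → as ⟶Ns bs → (a ∷ as) ⟶Ns (a ∷ bs)

  mutual
    data _⟶T_ : Term → Term → Set where
      rootT : ∀ {f es ts r} (θn : ℕ → NExp) (θt : ℕ → Term) → trule f es ts r ∈ E →
              dfn f (map (instN θn) es) (instTs θn θt ts) ⟶T instT θn θt r
      svT   : ∀ {x a b} → a ⟶N b → sv x a ⟶T sv x b
      fnT   : ∀ {f ts us} → ts ⟶Ts us → fn f ts ⟶T fn f us
      dfnNT : ∀ {f es es' ts} → es ⟶Ns es' → dfn f es ts ⟶T dfn f es' ts
      dfnTT : ∀ {f es ts us} → ts ⟶Ts us → dfn f es ts ⟶T dfn f es us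

    data _⟶Ts_ : List Term → List Term → Set where
      hereTs  : ∀ {a b as} → a ⟶T b → (a ∷ as) ⟶Ts (b ∷ as)
      thereTs : ∀ {a as bs} → as ⟶Ts bs → (a ∷ as) ⟶Ts (a ∷ bs)

  data _⟶F_ : Formula → Formula → Set where
    rootF : ∀ {P es ts r} (θn : ℕ → NExp) (θt : ℕ → Term) → prule P es ts r ∈ E →
            dpr P (map (instN θn) es) (instTs θn θt ts) ⟶F instF θn θt r
    prF   : ∀ {P ts us} → ts ⟶Ts us → pr P ts ⟶F pr P us
    dprNF : ∀ {P es es' ts} → es ⟶Ns es' → dpr P es ts ⟶F dpr P es' ts
    dprTF : ∀ {P es ts us} → ts ⟶Ts us → dpr P es ts ⟶F dpr P es us
    ¬F    : ∀ {A A'} → A ⟶F A' → ¬' A ⟶F ¬' A'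
    ∧lF   : ∀ {A A' B} → A ⟶F A' → (A ∧' B) ⟶F (A' ∧' B)
    ∧rF   : ∀ {A B B'} → B ⟶F B' → (A ∧' B) ⟶F (A ∧' B')
    ∨lF   : ∀ {A A' B} → A ⟶F A' → (A ∨' B) ⟶F (A' ∨' B)
    ∨rF   : ∀ {A B B'} → B ⟶F B' → (A ∨' B) ⟶F (A ∨' B')
    ⇒lF   : ∀ {A A' B} → A ⟶F A' → (A ⇒' B) ⟶F (A' ⇒' B)
    ⇒rF   : ∀ {A B B'} → B ⟶F B' → (A ⇒' B) ⟶F (A ⇒' B')
    ∀F    : ∀ {A A'} → A ⟶F A' → ∀' A ⟶F ∀' A'
    ∃F    : ∀ {A A'} → A ⟶F A' → ∃' A ⟶F ∃' A'

  data _⟶Fs_ : List Formula → List Formula → Set where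
    hereFs  : ∀ {a b as} → a ⟶F b → (a ∷ as) ⟶Fs (b ∷ as)
    thereFs : ∀ {a as bs} → as ⟶Fs bs → (a ∷ as) ⟶Fs (a ∷ bs)

  data _⟶S_ : Sequent → Sequent → Set where
    anteS : ∀ {Γ Γ' Δ} → Γ ⟶Fs Γ' → (Γ ⊢ Δ) ⟶S (Γ' ⊢ Δ)
    succS : ∀ {Γ Δ Δ'} → Δ ⟶Fs Δ' → (Γ ⊢ Δ) ⟶S (Γ ⊢ Δ')

  -- S(t) and S(t') with E ⊨ t ≡ t' (iterated replacements of E-equal subexpressions)
  _≡E_ : Sequent → Sequent → Set
  _≡E_ = EqClosure _⟶S_

Terminating : {A : Set} → (A → A → Set) → Set
Terminating R = WellFounded (flip R)

Confluent : {A : Set} → (A → A → Set) → Set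
Confluent R = ∀ {a b c} → Star R a b → Star R a c → ∃ λ d → Star R b d × Star R c d

mutual
  noDefN : NExp → Bool
  noDefN nzero      = true
  noDefN (nsuc e)   = noDefN e
  noDefN npar       = true
  noDefN (nv _)     = true
  noDefN (nfun _ _) = false

  noDefNs : List NExp → Bool
  noDefNs []       = true
  noDefNs (e ∷ es) = noDefN e ∧ noDefNs es

mutual
  noDefT : Term → Bool
  noDefT (bv _)      = true
  noDefT (mv _)      = true
  noDefT (sv _ e)    = noDefN e
  noDefT (fn _ ts)   = noDefTs ts
  noDefT (dfn _ _ _) = false

  noDefTs : List Term → Bool
  noDefTs []       = true
  noDefTs (t ∷ ts) = noDefT t ∧ noDefTs ts

LhsOK : ERule → Set
LhsOK (nrule _ es _)    = T (noDefNs es)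
LhsOK (trule _ es ts _) = T (noDefNs es ∧ noDefTs ts)
LhsOK (prule _ es ts _) = T (noDefNs es ∧ noDefTs ts)

record EqTheory (E : List ERule) : Set where
  field
    lhsOK   : All LhsOK E
    termN   : Terminating (_⟶N_ E)
    termT   : Terminating (_⟶T_ E)
    termF   : Terminating (_⟶F_ E)
    confN   : Confluent (_⟶N_ E)
    confT   : Confluent (_⟶T_ E)
    confF   : Confluent (_⟶F_ E)

data OccT (x : ℕ) (e : NExp) : Term → Set where
  occ-here : OccT x e (sv x e)
  occ-fn   : ∀ {f ts} → Any (OccT x e) ts → OccT x e (fn f ts)
  occ-dfn  : ∀ {f es ts} → Any (OccT x e) ts → OccT x e (dfn f es ts)

data OccF (x : ℕ) (e : NExp) : Formula → Set where
  occ-pr  : ∀ {P ts} → Any (OccT x e) ts → OccF x e (pr P ts)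
  occ-dpr : ∀ {P es ts} → Any (OccT x e) ts → OccF x e (dpr P es ts)
  occ-¬   : ∀ {A} → OccF x e A → OccF x e (¬' A)
  occ-∧l  : ∀ {A B} → OccF x e A → OccF x e (A ∧' B)
  occ-∧r  : ∀ {A B} → OccF x e B → OccF x e (A ∧' B)
  occ-∨l  : ∀ {A B} → OccF x e A → OccF x e (A ∨' B)
  occ-∨r  : ∀ {A B} → OccF x e B → OccF x e (A ∨' B)
  occ-⇒l  : ∀ {A B} → OccF x e A → OccF x e (A ⇒' B)
  occ-⇒r  : ∀ {A B} → OccF x e B → OccF x e (A ⇒' B)
  occ-∀   : ∀ {A} → OccF x e A → OccF x e (∀' A)
  occ-∃   : ∀ {A} → OccF x e A → OccF x e (∃' A)

OccS : ℕ → NExp → Sequent → Set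
OccS x e (Γ ⊢ Δ) = Any (OccF x e) Γ ⊎ Any (OccF x e) Δ

-- LKE (Gentzen's LK + E-rule), as relations premise(s) → conclusion.
-- Sequents are multisets: rules act at the head, exchange is provided
-- by working up to permutation (see _≈S_ below).

module _ (E : List ERule) where

  data LK1 : Sequent → Sequent → Set where
    wl  : ∀ {Γ Δ A} → LK1 (Γ ⊢ Δ) (A ∷ Γ ⊢ Δ)
    wr  : ∀ {Γ Δ A} → LK1 (Γ ⊢ Δ) (Γ ⊢ A ∷ Δ)
    cl  : ∀ {Γ Δ A} → LK1 (A ∷ A ∷ Γ ⊢ Δ) (A ∷ Γ ⊢ Δ)
    cr  : ∀ {Γ Δ A} → LK1 (Γ ⊢ A ∷ A ∷ Δ) (Γ ⊢ A ∷ Δ)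
    ¬l  : ∀ {Γ Δ A} → LK1 (Γ ⊢ A ∷ Δ) (¬' A ∷ Γ ⊢ Δ)
    ¬r  : ∀ {Γ Δ A} → LK1 (A ∷ Γ ⊢ Δ) (Γ ⊢ ¬' A ∷ Δ)
    ∧l₁ : ∀ {Γ Δ A B} → LK1 (A ∷ Γ ⊢ Δ) ((A ∧' B) ∷ Γ ⊢ Δ)
    ∧l₂ : ∀ {Γ Δ A B} → LK1 (B ∷ Γ ⊢ Δ) ((A ∧' B) ∷ Γ ⊢ Δ)
    ∨r₁ : ∀ {Γ Δ A B} → LK1 (Γ ⊢ A ∷ Δ) (Γ ⊢ (A ∨' B) ∷ Δ)
    ∨r₂ : ∀ {Γ Δ A B} → LK1 (Γ ⊢ B ∷ Δ) (Γ ⊢ (A ∨' B) ∷ Δ)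
    ⇒r  : ∀ {Γ Δ A B} → LK1 (A ∷ Γ ⊢ B ∷ Δ) (Γ ⊢ (A ⇒' B) ∷ Δ)
    ∀l  : ∀ {Γ Δ A} (t : Term) → LK1 (inst A t ∷ Γ ⊢ Δ) (∀' A ∷ Γ ⊢ Δ)
    ∀r  : ∀ {Γ Δ A x α} → ¬ OccS x α (Γ ⊢ ∀' A ∷ Δ) →
          LK1 (Γ ⊢ inst A (sv x α) ∷ Δ) (Γ ⊢ ∀' A ∷ Δ)
    ∃l  : ∀ {Γ Δ A x α} → ¬ OccS x α (∃' A ∷ Γ ⊢ Δ) →
          LK1 (inst A (sv x α) ∷ Γ ⊢ Δ) (∃' A ∷ Γ ⊢ Δ)
    ∃r  : ∀ {Γ Δ A} (t : Term) → LK1 (Γ ⊢ inst A t ∷ Δ) (Γ ⊢ ∃' A ∷ Δ)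
    eqE : ∀ {S S'} → _≡E_ E S S' → LK1 S S'

  data LK2 : Sequent → Sequent → Sequent → Set where
    cut : ∀ {Γ Δ Π Λ A} → LK2 (Γ ⊢ A ∷ Δ) (A ∷ Π ⊢ Λ) (Γ ++ Π ⊢ Δ ++ Λ)
    ∧r  : ∀ {Γ Δ A B} → LK2 (Γ ⊢ A ∷ Δ) (Γ ⊢ B ∷ Δ) (Γ ⊢ (A ∧' B) ∷ Δ)
    ∨l  : ∀ {Γ Δ A B} → LK2 (A ∷ Γ ⊢ Δ) (B ∷ Γ ⊢ Δ) ((A ∨' B) ∷ Γ ⊢ Δ)
    ⇒l  : ∀ {Γ Δ Π Λ A B} → LK2 (Γ ⊢ A ∷ Δ) (B ∷ Π ⊢ Λ) ((A ⇒' B) ∷ Γ ++ Π ⊢ Δ ++ Λ)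

data Stepcase : Set where
  ⊤sc  : Stepcase
  ann  : Sequent → NExp → Stepcase       -- Λ ⊢^α Γ
  [_]sc : Sequent → Stepcase
  []sc : Stepcase

data Basecase : Set where
  seq   : Sequent → Basecase
  [_]bc : Sequent → Basecase

record CPair : Set where
  constructor ⟨_︔_⟩
  field
    stepcase : Stepcase
    basecase : Basecase

Group : Set
Group = List CPair

Collection : Set
Collection = List Group

data Closed : Group → Set where
  closedS : ∀ {S b} → Closed (⟨ [ S ]sc ︔ b ⟩ ∷ [])
  closedE : ∀ {b}   → Closed (⟨ []sc ︔ b ⟩ ∷ [])

Open : Group → Set
Open G = ¬ Closed G

AllClosed : Collection → Set
AllClosed = All Closed

_≈S_ : Sequent → Sequent → Set
(Γ ⊢ Δ) ≈S (Γ' ⊢ Δ') = (Γ ↭ Γ') × (Δ ↭ Δ')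

data _≈sc_ : Stepcase → Stepcase → Set where
  ⊤≈  : ⊤sc ≈sc ⊤sc
  ann≈ : ∀ {S S' α} → S ≈S S' → ann S α ≈sc ann S' α
  cl≈  : ∀ {S S'} → S ≈S S' → [ S ]sc ≈sc [ S' ]sc
  []≈  : []sc ≈sc []sc

data _≈bc_ : Basecase → Basecase → Set where
  seq≈ : ∀ {S S'} → S ≈S S' → seq S ≈bc seq S'
  cl≈  : ∀ {S S'} → S ≈S S' → [ S ]bc ≈bc [ S' ]bc

_≈P_ : CPair → CPair → Set
⟨ ν ︔ π ⟩ ≈P ⟨ ν' ︔ π' ⟩ = (ν ≈sc ν') × (π ≈bc π')

_≈G_ : Group → Group → Set
_≈G_ = PH.Permutation _≈P_

_≈C_ : Collection → Collection → Set
_≈C_ = PH.Permutation _≈G_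

-- SiLK rules (acting on the head group / head pairs; arbitrary position
-- is obtained via multiset equality in Step)

module _ (E : List ERule) where

  data Rule : Collection → Collection → Set where
    Ax₁r : ∀ {Π A} →
      Rule Π ((⟨ ⊤sc ︔ seq (A ∷ [] ⊢ A ∷ []) ⟩ ∷ []) ∷ Π)
    Ax₂r : ∀ {𝔾 Π A} → Open 𝔾 →
      Rule (𝔾 ∷ Π) ((⟨ ⊤sc ︔ seq (A ∷ [] ⊢ A ∷ []) ⟩ ∷ 𝔾) ∷ Π)
    Axl : ∀ {π 𝔾 Π A} (f : NExp) → Open (⟨ ⊤sc ︔ [ π ]bc ⟩ ∷ 𝔾) →
      Rule ((⟨ ⊤sc ︔ [ π ]bc ⟩ ∷ 𝔾) ∷ Π)
           ((⟨ ann (A ∷ [] ⊢ A ∷ []) f ︔ [ π ]bc ⟩ ∷ 𝔾) ∷ Π)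
    ccr : ∀ {π 𝔾 Π} → Open (⟨ ⊤sc ︔ π ⟩ ∷ ⟨ ⊤sc ︔ π ⟩ ∷ 𝔾) →
      Rule ((⟨ ⊤sc ︔ π ⟩ ∷ ⟨ ⊤sc ︔ π ⟩ ∷ 𝔾) ∷ Π) ((⟨ ⊤sc ︔ π ⟩ ∷ 𝔾) ∷ Π)
    ccl : ∀ {ν π 𝔾 Π} → Open (⟨ ν ︔ [ π ]bc ⟩ ∷ ⟨ ν ︔ [ π ]bc ⟩ ∷ 𝔾) →
      Rule ((⟨ ν ︔ [ π ]bc ⟩ ∷ ⟨ ν ︔ [ π ]bc ⟩ ∷ 𝔾) ∷ Π) ((⟨ ν ︔ [ π ]bc ⟩ ∷ 𝔾) ∷ Π)
    br : ∀ {ν π 𝔾 Π} → Open (⟨ ν ︔ [ π ]bc ⟩ ∷ 𝔾) →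
      Rule ((⟨ ν ︔ [ π ]bc ⟩ ∷ 𝔾) ∷ Π) ((⟨ ⊤sc ︔ [ π ]bc ⟩ ∷ ⟨ ν ︔ [ π ]bc ⟩ ∷ 𝔾) ∷ Π)
    clbc : ∀ {ν 𝔾 Π} → Open (⟨ ⊤sc ︔ seq ν ⟩ ∷ 𝔾) →
      Rule ((⟨ ⊤sc ︔ seq ν ⟩ ∷ 𝔾) ∷ Π) ((⟨ ⊤sc ︔ [ ν ]bc ⟩ ∷ 𝔾) ∷ Π)
    clLKE : ∀ {ν Π} → Open (⟨ ⊤sc ︔ [ ν ]bc ⟩ ∷ []) →
      Rule ((⟨ ⊤sc ︔ [ ν ]bc ⟩ ∷ []) ∷ Π) ((⟨ []sc ︔ [ ν ]bc ⟩ ∷ []) ∷ Π)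
    clsc : ∀ {S α Π} → Open (⟨ ann (parS α S) α ︔ [ parS nzero S ]bc ⟩ ∷ []) →
      Rule ((⟨ ann (parS α S) α ︔ [ parS nzero S ]bc ⟩ ∷ []) ∷ Π)
           ((⟨ [ parS α S ]sc ︔ [ parS nzero S ]bc ⟩ ∷ []) ∷ Π)
    ρ₁bc : ∀ {π π' 𝔾 Π} → LK1 E π π' → Open (⟨ ⊤sc ︔ seq π ⟩ ∷ 𝔾) →
      Rule ((⟨ ⊤sc ︔ seq π ⟩ ∷ 𝔾) ∷ Π) ((⟨ ⊤sc ︔ seq π' ⟩ ∷ 𝔾) ∷ Π)
    ρ₂bc : ∀ {π η π' 𝔾 Π} → LK2 E π η π' → Open (⟨ ⊤sc ︔ seq π ⟩ ∷ ⟨ ⊤sc ︔ seq η ⟩ ∷ 𝔾) →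
      Rule ((⟨ ⊤sc ︔ seq π ⟩ ∷ ⟨ ⊤sc ︔ seq η ⟩ ∷ 𝔾) ∷ Π) ((⟨ ⊤sc ︔ seq π' ⟩ ∷ 𝔾) ∷ Π)
    ρ₁sc : ∀ {ν ν' α π 𝔾 Π} → LK1 E ν ν' → Open (⟨ ann ν α ︔ [ π ]bc ⟩ ∷ 𝔾) →
      Rule ((⟨ ann ν α ︔ [ π ]bc ⟩ ∷ 𝔾) ∷ Π) ((⟨ ann ν' α ︔ [ π ]bc ⟩ ∷ 𝔾) ∷ Π)
    ρ₂sc : ∀ {ν μ ν' α π 𝔾 Π} → LK2 E ν μ ν' →
      Open (⟨ ann ν α ︔ [ π ]bc ⟩ ∷ ⟨ ann μ α ︔ [ π ]bc ⟩ ∷ 𝔾) →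
      Rule ((⟨ ann ν α ︔ [ π ]bc ⟩ ∷ ⟨ ann μ α ︔ [ π ]bc ⟩ ∷ 𝔾) ∷ Π)
           ((⟨ ann ν' α ︔ [ π ]bc ⟩ ∷ 𝔾) ∷ Π)
    -- ↻  (σ gives the arbitrary terms t̄ for the free variables x̄)
    loop : ∀ {S 𝔾 Π} (σ : ℕ → NExp → Term) →
      Open (⟨ ⊤sc ︔ [ parS nzero S ]bc ⟩ ∷ 𝔾) →
      Rule ((⟨ ⊤sc ︔ [ parS nzero S ]bc ⟩ ∷ 𝔾) ∷ Π)
           ((⟨ ann (svS σ (parS npar S)) (nsuc npar) ︔ [ parS nzero S ]bc ⟩ ∷ 𝔾) ∷ Π)
    -- ↷  (link to a closed group; f, g, h numeric expressions in n)
    link : ∀ {π S δ 𝔾 Π} (f g h : NExp) (σ : ℕ → NExp → Term) →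
      Open (⟨ ⊤sc ︔ [ π ]bc ⟩ ∷ 𝔾) →
      Rule ((⟨ ⊤sc ︔ [ π ]bc ⟩ ∷ 𝔾) ∷ (⟨ [ parS h S ]sc ︔ [ δ ]bc ⟩ ∷ []) ∷ Π)
           ((⟨ ann (svS σ (parS g S)) f ︔ [ π ]bc ⟩ ∷ 𝔾)
              ∷ (⟨ [ parS h S ]sc ︔ [ δ ]bc ⟩ ∷ []) ∷ Π)

  record Step (C C' : Collection) : Set where
    constructor mkStep
    field
      {P Q} : Collection
      pre   : C ≈C P
      rule  : Rule P Q
      post  : Q ≈C C'

  data Deriv : Collection → Set where
    init : Deriv []
    _▷_  : ∀ {C C'} → Deriv C → Step C C' → Deriv C'

  SiLKProof : Collection → Set
  SiLKProof C = Deriv C × AllClosed C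

  IsAx₁r : ∀ {P Q} → Rule P Q → Set
  IsAx₁r Ax₁r = ⊤
  IsAx₁r _    = ⊥

  NormalForm : ∀ {C} → Deriv C → Set
  NormalForm init = ⊤
  NormalForm (_▷_ {C} d s) = NormalForm d × (IsAx₁r (Step.rule s) → SiLKProof C)

-- Postpone every group until it is closed.  A group that becomes closed
-- is rebuilt from scratch, replaying its whole history on top of the collection of
-- the groups closed before it.  That collection is all closed and already carries a
-- normal proof, so each Ax₁:r of the replay has a premise that is the conclusion of a
-- proof; and a link ↷ only ever targets a closed group, which has then already been
-- rebuilt.
module Submission where

open import Defs
open import Data.List using (List; []; _∷_; _++_)
open import Data.List.Relation.Unary.All using (All; []; _∷_; lookupAny)
import Data.List.Relation.Unary.All as All
open import Data.List.Relation.Unary.Any using (here)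
import Data.List.Relation.Unary.Any.Properties as Any
open import Data.List.Relation.Binary.Pointwise using ([]; _∷_)
import Data.List.Relation.Binary.Permutation.Homogeneous as Homogeneous
import Data.List.Relation.Binary.Permutation.Propositional as Propositional
open import Data.Product using (Σ; ∃; _×_; _,_; proj₁; proj₂)
open import Data.Sum using (inj₁; inj₂)
open import Data.Empty using (⊥-elim)
open import Data.Unit using (tt)
open import Function using (_∘_)
open import Relation.Nullary using (¬_; yes; no)
open import Relation.Unary using (Decidable)
open import Relation.Binary.Core using (Rel)
open import Relation.Binary.Definitions using (_Respects_)
open import Relation.Binary.Bundles using (Setoid)
open import Relation.Binary.PropositionalEquality using (_≡_; refl)

≈S-refl : ∀ {S} → S ≈S S
≈S-refl {Γ ⊢ Δ} = Propositional.↭-refl , Propositional.↭-refl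

≈S-sym : ∀ {S S'} → S ≈S S' → S' ≈S S
≈S-sym {Γ ⊢ Δ} {Γ' ⊢ Δ'} (Γ↭Γ' , Δ↭Δ') = Propositional.↭-sym Γ↭Γ' , Propositional.↭-sym Δ↭Δ'

≈sc-refl : ∀ {ν} → ν ≈sc ν
≈sc-refl {⊤sc}     = ⊤≈
≈sc-refl {ann S α} = ann≈ ≈S-refl
≈sc-refl {[ S ]sc} = cl≈ ≈S-refl
≈sc-refl {[]sc}    = []≈

≈sc-sym : ∀ {ν ν'} → ν ≈sc ν' → ν' ≈sc ν
≈sc-sym ⊤≈       = ⊤≈
≈sc-sym (ann≈ p) = ann≈ (≈S-sym p)
≈sc-sym (cl≈ p)  = cl≈ (≈S-sym p)
≈sc-sym []≈      = []≈

≈bc-refl : ∀ {π} → π ≈bc π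
≈bc-refl {seq S}   = seq≈ ≈S-refl
≈bc-refl {[ S ]bc} = cl≈ ≈S-refl

≈bc-sym : ∀ {π π'} → π ≈bc π' → π' ≈bc π
≈bc-sym (seq≈ p) = seq≈ (≈S-sym p)
≈bc-sym (cl≈ p)  = cl≈ (≈S-sym p)

≈P-refl : ∀ {p} → p ≈P p
≈P-refl = ≈sc-refl , ≈bc-refl

≈P-sym : ∀ {p q} → p ≈P q → q ≈P p
≈P-sym (ν≈ν' , π≈π') = ≈sc-sym ν≈ν' , ≈bc-sym π≈π'

groupSetoid : Setoid _ _
groupSetoid = Homogeneous.setoid {R = _≈P_} ≈P-refl ≈P-sym

open Setoid groupSetoid using () renaming (refl to ≈G-refl; sym to ≈G-sym)
open import Data.List.Membership.Setoid groupSetoid using (_∈_)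
open import Data.List.Membership.Setoid.Properties using (∈-∃++)
open import Data.List.Relation.Binary.Subset.Setoid groupSetoid using (_⊆_)
open import Data.List.Relation.Binary.Subset.Setoid.Properties using (⊆-refl; ⊆-trans; xs⊆x∷xs)
open import Data.List.Relation.Binary.Permutation.Setoid groupSetoid
  using (↭-refl; ↭-sym; ↭-trans; prep; refl)
open import Data.List.Relation.Binary.Permutation.Setoid.Properties groupSetoid
  using (All-resp-↭; ∈-resp-↭; ++⁺ʳ; ↭-shift; drop-∷) renaming (shift to ↭-shift-≈)

[]↭ys⇒ys≡[] : ∀ {a r} {A : Set a} {R : Rel A r} {ys} → Homogeneous.Permutation R [] ys → ys ≡ []
[]↭ys⇒ys≡[] (Homogeneous.refl [])  = refl
[]↭ys⇒ys≡[] (Homogeneous.trans p q) with []↭ys⇒ys≡[] p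
... | refl = []↭ys⇒ys≡[] q

∈⇒↭∷ : ∀ {G C} → G ∈ C → ∃ λ C' → C ≈C (G ∷ C')
∈⇒↭∷ G∈C with ∈-∃++ groupSetoid G∈C
... | C₁ , C₂ , _ , G≈H , C≋ = C₁ ++ C₂ , ↭-trans (refl C≋) (↭-shift-≈ (≈G-sym G≈H) C₁ C₂)

Closed-≈P : ∀ {p q} → Closed (p ∷ []) → p ≈P q → Closed (q ∷ [])
Closed-≈P closedS (cl≈ _ , _) = closedS
Closed-≈P closedE ([]≈ , _)   = closedE

Closed-resp : Closed Respects _≈G_
Closed-resp {_ ∷ _ ∷ _} _                                ()
Closed-resp              (Homogeneous.refl (p≈q ∷ []))   c = Closed-≈P c p≈q
Closed-resp {_ ∷ []}     (Homogeneous.prep p≈q ps)       c with []↭ys⇒ys≡[] ps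
... | refl = Closed-≈P c p≈q
Closed-resp              (Homogeneous.trans G≈H H≈G') c = Closed-resp H≈G' (Closed-resp G≈H c)

Open-resp : Open Respects _≈G_
Open-resp G≈G' o c = o (Closed-resp (≈G-sym G≈G') c)

closed? : Decidable Closed
closed? []                        = no λ ()
closed? (⟨ ⊤sc ︔ _ ⟩ ∷ [])        = no λ ()
closed? (⟨ ann _ _ ︔ _ ⟩ ∷ [])    = no λ ()
closed? (⟨ [ _ ]sc ︔ _ ⟩ ∷ [])    = yes closedS
closed? (⟨ []sc ︔ _ ⟩ ∷ [])       = yes closedE
closed? (_ ∷ _ ∷ _)               = no λ ()

open∈ˡ : ∀ {G O K} → Open G → AllClosed K → G ∈ O ++ K → G ∈ O
open∈ˡ {O = O} o closed G∈ with Any.++⁻ O G∈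
... | inj₁ G∈O = G∈O
... | inj₂ G∈K = let c , G≈H = lookupAny closed G∈K in ⊥-elim (o (Closed-resp (≈G-sym G≈H) c))

closed∈ʳ : ∀ {H O K} → Closed H → All Open O → H ∈ O ++ K → H ∈ K
closed∈ʳ {O = O} c opens H∈ with Any.++⁻ O H∈
... | inj₁ H∈O = let o , H≈G = lookupAny opens H∈O in ⊥-elim (o (Closed-resp H≈G c))
... | inj₂ H∈K = H∈K

module _ (E : List ERule) where

  NormalDerivation : Collection → Set
  NormalDerivation C = Σ (Deriv E C) (NormalForm E)

  NormalProof : Collection → Set
  NormalProof C = NormalDerivation C × AllClosed C

  NormalDerivation-resp : NormalDerivation Respects _≈C_
  NormalDerivation-resp {y = []}    _ (init , _) = init , tt
  NormalDerivation-resp {y = _ ∷ _} p (init , _) with []↭ys⇒ys≡[] p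
  ... | ()
  NormalDerivation-resp p (d ▷ mkStep pre r post , nf) = d ▷ mkStep pre r (↭-trans post p) , nf

  extend : ∀ {P Q} → NormalDerivation P → (r : Rule E P Q) → (IsAx₁r E r → AllClosed P) →
           NormalDerivation Q
  extend (d , nf) r premiseClosed = d ▷ mkStep ↭-refl r ↭-refl , nf , λ ax → d , premiseClosed ax

  -- Quantifying over all extensions of K lets the construction of G wait until further
  -- groups have been closed and built.
  Buildable : Collection → Group → Set
  Buildable K G = ∀ {K'} → K ⊆ K' → NormalProof K' → NormalDerivation (G ∷ K')

  Buildable-resp : ∀ {K} → Buildable K Respects _≈G_
  Buildable-resp G≈G' build K⊆K' proof = NormalDerivation-resp (prep G≈G' ↭-refl) (build K⊆K' proof)

  Pending : Collection → Group → Set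
  Pending K G = Open G × Buildable K G

  Pending-resp : ∀ {K} → Pending K Respects _≈G_
  Pending-resp G≈G' (o , build) = Open-resp G≈G' o , Buildable-resp G≈G' build

  Pending-mono : ∀ {K₁ K₂ G} → K₁ ⊆ K₂ → Pending K₁ G → Pending K₂ G
  Pending-mono K₁⊆K₂ (o , build) = o , λ K₂⊆K' → build (⊆-trans groupSetoid K₁⊆K₂ K₂⊆K')

  record Staged (C : Collection) : Set where
    constructor staged
    field
      {built pending} : Collection
      builtProof      : NormalProof built
      split           : C ≈C (pending ++ built)
      pendingOk       : All (Pending built) pending

  Staged-resp : Staged Respects _≈C_
  Staged-resp C≈C' (staged proof split pending) = staged proof (↭-trans (↭-sym C≈C') split) pending

  -- Uniformity in the remaining groups Π is what allows a rule to be replayed in another context.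
  data Shape : Collection → Collection → Set where
    axiom  : ∀ {Π A} → Shape Π ((⟨ ⊤sc ︔ seq (A ∷ [] ⊢ A ∷ []) ⟩ ∷ []) ∷ Π)
    local  : ∀ {G G' Π} → Open G → (r : ∀ Π → Rule E (G ∷ Π) (G' ∷ Π)) →
             (∀ Π → ¬ IsAx₁r E (r Π)) → Shape (G ∷ Π) (G' ∷ Π)
    linked : ∀ {G G' H Π} → Open G → Closed H → (r : ∀ Π → Rule E (G ∷ H ∷ Π) (G' ∷ H ∷ Π)) →
             (∀ Π → ¬ IsAx₁r E (r Π)) → Shape (G ∷ H ∷ Π) (G' ∷ H ∷ Π)

  shape : ∀ {P Q} → Rule E P Q → Shape P Q
  shape Ax₁r             = axiom
  shape (Ax₂r o)         = local o (λ _ → Ax₂r o) (λ _ ())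
  shape (Axl f o)        = local o (λ _ → Axl f o) (λ _ ())
  shape (ccr o)          = local o (λ _ → ccr o) (λ _ ())
  shape (ccl o)          = local o (λ _ → ccl o) (λ _ ())
  shape (br o)           = local o (λ _ → br o) (λ _ ())
  shape (clbc o)         = local o (λ _ → clbc o) (λ _ ())
  shape (clLKE o)        = local o (λ _ → clLKE o) (λ _ ())
  shape (clsc o)         = local o (λ _ → clsc o) (λ _ ())
  shape (ρ₁bc ρ o)       = local o (λ _ → ρ₁bc ρ o) (λ _ ())
  shape (ρ₂bc ρ o)       = local o (λ _ → ρ₂bc ρ o) (λ _ ())
  shape (ρ₁sc ρ o)       = local o (λ _ → ρ₁sc ρ o) (λ _ ())
  shape (ρ₂sc ρ o)       = local o (λ _ → ρ₂sc ρ o) (λ _ ())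
  shape (loop σ o)       = local o (λ _ → loop σ o) (λ _ ())
  shape (link f g h σ o) = linked o closedS (λ _ → link f g h σ o) (λ _ ())

  Buildable-local : ∀ {K G G'} (r : ∀ Π → Rule E (G ∷ Π) (G' ∷ Π)) → (∀ Π → ¬ IsAx₁r E (r Π)) →
                    Buildable K G → Buildable K G'
  Buildable-local r nonAxiom build K⊆K' proof = extend (build K⊆K' proof) (r _) (⊥-elim ∘ nonAxiom _)

  Buildable-linked : ∀ {K G G' H} → H ∈ K → (r : ∀ Π → Rule E (G ∷ H ∷ Π) (G' ∷ H ∷ Π)) →
                     (∀ Π → ¬ IsAx₁r E (r Π)) → Buildable K G → Buildable K G'
  Buildable-linked H∈K r nonAxiom build K⊆K' proof with ∈⇒↭∷ (K⊆K' H∈K)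
  ... | K'' , K'↭ = NormalDerivation-resp (prep ≈G-refl (↭-sym K'↭))
    (extend (NormalDerivation-resp (prep ≈G-refl K'↭) (build K⊆K' proof)) (r K'')
            (⊥-elim ∘ nonAxiom K''))

  takePending : ∀ {G Π O K} → Open G → (G ∷ Π) ≈C (O ++ K) → AllClosed K → All (Pending K) O →
                ∃ λ O' → Buildable K G × All (Pending K) O' × Π ≈C (O' ++ K)
  takePending {O = O} {K} o split closed pending
    with ∈⇒↭∷ (open∈ˡ {O = O} o closed (∈-resp-↭ split (here ≈G-refl)))
  ... | O' , O↭ with All-resp-↭ Pending-resp O↭ pending
  ... | (_ , build) ∷ pending' = O' , build , pending' , drop-∷ (↭-trans split (++⁺ʳ K O↭))

  settle : ∀ {K G O Π} → NormalProof K → Buildable K G → All (Pending K) O → Π ≈C (O ++ K) →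
           Staged (G ∷ Π)
  settle {K} {G} {O} proof build pending split with closed? G
  ... | yes c = staged (build (⊆-refl groupSetoid) proof , c ∷ proj₂ proof)
                       (↭-trans (prep ≈G-refl split) (↭-sym (↭-shift O K)))
                       (All.map (Pending-mono (xs⊆x∷xs groupSetoid K G)) pending)
  ... | no o  = staged proof (prep ≈G-refl split) ((o , build) ∷ pending)

  Staged-step : ∀ {P Q} → Staged P → Shape P Q → Staged Q
  Staged-step (staged proof split pending) axiom =
    staged proof (prep ≈G-refl split)
           (((λ ()) , λ _ (d , closed) → extend d Ax₁r (λ _ → closed)) ∷ pending)
  Staged-step (staged proof split pending) (local o r nonAxiom)
    with takePending o split (proj₂ proof) pending
  ... | _ , build , pending' , split' =
    settle proof (Buildable-local r nonAxiom build) pending' split'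
  Staged-step (staged proof split pending) (linked o c r nonAxiom)
    with takePending o split (proj₂ proof) pending
  ... | O' , build , pending' , split' =
    let H∈built = closed∈ʳ {O = O'} c (All.map proj₁ pending') (∈-resp-↭ split' (here ≈G-refl))
    in settle proof (Buildable-linked H∈built r nonAxiom build) pending' split'

  stage : ∀ {C} → Deriv E C → Staged C
  stage init                     = staged ((init , tt) , []) ↭-refl []
  stage (d ▷ mkStep pre r post) = Staged-resp post (Staged-step (Staged-resp pre (stage d)) (shape r))

  unstage : ∀ {C} → Staged C → AllClosed C → NormalDerivation C
  unstage (staged {pending = []} (d , _) split _) _ = NormalDerivation-resp (↭-sym split) d
  unstage (staged {pending = G ∷ _} _ split ((o , _) ∷ _)) closed
    with lookupAny closed (∈-resp-↭ (↭-sym split) (here ≈G-refl))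
  ... | c , G≈H = ⊥-elim (o (Closed-resp (≈G-sym G≈H) c))

mainTheorem1 : (E : List ERule) → EqTheory E → (C : Collection) →
    SiLKProof E C → Σ (SiLKProof E C) (λ Φ' → NormalForm E (proj₁ Φ'))
mainTheorem1 E _ C (d , closed) with unstage E (stage E d) closed
... | d' , normal = (d' , closed) , normal
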